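{- Let $s\ge0$ be an integer, $h\in\mathbb C\setminus\{0\}$ and $q\in\mathbb C\setminus\{0\}$. For all nonnegative integers $n,m,k$, $$S_{s,h,q}[n+m,k]=\sum_{r=0}^n\sum_{j=0}^mh^{n-r}q^{r(j(1-s)+sm)}\genfrac{[}{]}{0pt}{}{n}{r}_{q^s}S_{s,h,q}[m,j]\,S_{s,h,q}[r,k-j]\prod_{i=0}^{n-r-1}[j(1-s)+sm+si]_q .$$ Moreover, $$B_{s,h,q}[n+m]=\sum_{r=0}^n\sum_{j=0}^mh^{n-r}q^{r(j(1-s)+sm)}\genfrac{[}{]}{0pt}{}{n}{r}_{q^s}S_{s,h,q}[m,j]\,B_{s,h,q}[r]\prod_{i=0}^{n-r-1}[j(1-s)+sm+si]_q .$$
   Context: For an integer $x$, $[x]_q=\frac{q^x-1}{q-1}$ if $q\ne1$ and $[x]_1=x$. $\genfrac{[}{]}{0pt}{}{n}{k}_p$ is the Gaussian ($p$-binomial) coefficient, understood as a polynomial in $p$ evaluated at the given value. The numbers $S_{s,h,q}[n,k]$ are the coefficients in $(VU)^n=\sum_{k=0}^nS_{s,h,q}[n,k]V^{sn-(s-1)k}U^k$, where $UV-qVU=hV^s$; equivalently they are determined by $S_{s,h,q}[n,k]=q^{s(n-1)-(s-1)(k-1)}S_{s,h,q}[n-1,k-1]+h[s(n-1)-(s-1)k]_q\,S_{s,h,q}[n-1,k]$ for $n,k\ge1$, with $S_{s,h,q}[n,0]=S_{s,h,q}[0,n]=\delta_{0,n}$; also $S_{s,h,q}[n,k]=0$ for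 $k<0$. The generalized $q$-Bell numbers are $B_{s,h,q}[n]=\sum_{k=0}^nS_{s,h,q}[n,k]$. Empty products equal $1$. -}

module Defs where

open import Algebra.Apartness using (HeytingField; HeytingCommutativeRing)
open import Algebra.Bundles using (CommutativeRing; CommutativeSemiring; Semiring)
open import Data.Fin.Base using (toℕ)
open import Data.Integer.Base as ℤ using (ℤ; +_; -[1+_])
open import Data.Nat.Base as ℕ using (ℕ; zero; suc)
import Data.Nat.Properties as ℕ
open import Data.Product.Base using (proj₁)
open import Data.Vec.Functional using (Vector)
open import Relation.Binary.PropositionalEquality.Core as ≡ using (_≡_)
open import Relation.Nullary.Decidable.Core using (Dec; yes; no)
import Algebra.Definitions.RawSemiring as RawSemiringDefs
import Algebra.Properties.Monoid.Sum as MonoidSum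
import Algebra.Properties.Semiring.Exp as SemiringExp
import Algebra.Solver.Ring.NaturalCoefficients.Default as RingSolver
import Relation.Binary.Reasoning.Setoid as ≈-Reasoning

-- Gaussian coefficients: a polynomial in p with natural number coefficients,
-- evaluated in an arbitrary commutative semiring.  As p may be a root of unity,
-- quotients of p-factorials are not available after evaluation; the polynomial
-- is generated by the p-Pascal rule instead.  gaussian-! and gaussian-> show that
-- it is [n]! / ([k]! [n-k]!) for k ≤ n, and 0 for k > n.
module Gaussian {c ℓ} (R : CommutativeSemiring c ℓ) (p : CommutativeSemiring.Carrier R) where

  open CommutativeSemiring R hiding (zero)
  open SemiringExp semiring using (_^_)

  gaussian : ℕ → ℕ → Carrier
  gaussian n       zero    = 1#
  gaussian zero    (suc k) = 0#
  gaussian (suc n) (suc k) = gaussian n k + p ^ suc k * gaussian n (suc k)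

  -- 1 + p + … + p ^ (n - 1)
  bracket : ℕ → Carrier
  bracket zero    = 0#
  bracket (suc n) = 1# + p * bracket n

  factorial : ℕ → Carrier
  factorial zero    = 1#
  factorial (suc n) = bracket (suc n) * factorial n

  private
    open ≈-Reasoning setoid
    open RingSolver R using (solve; _:=_; _:+_; _:*_)

    bracket-+ : ∀ k l → bracket (k ℕ.+ l) ≈ bracket k + p ^ k * bracket l
    bracket-+ zero    l = sym (trans (+-identityˡ _) (*-identityˡ _))
    bracket-+ (suc k) l = begin
      1# + p * bracket (k ℕ.+ l)                   ≈⟨ +-congˡ (*-congˡ (bracket-+ k l)) ⟩
      1# + p * (bracket k + p ^ k * bracket l)     ≈⟨ solve 5 (λ o p b e d → o :+ p :* (b :+ e :* d) := (o :+ p :* b) :+ (p :* e) :* d) refl 1# p (bracket k) (p ^ k) (bracket l) ⟩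
      bracket (suc k) + p ^ suc k * bracket l      ∎

  gaussian-> : ∀ {n k} → n ℕ.< k → gaussian n k ≈ 0#
  gaussian-> {zero}  {suc k} _           = refl
  gaussian-> {suc n} {suc k} (ℕ.s≤s n<k) = begin
    gaussian n k + p ^ suc k * gaussian n (suc k)
      ≈⟨ +-cong (gaussian-> n<k) (*-congˡ (gaussian-> (ℕ.m<n⇒m<1+n n<k))) ⟩
    0# + p ^ suc k * 0#  ≈⟨ +-identityˡ _ ⟩
    p ^ suc k * 0#       ≈⟨ zeroʳ _ ⟩
    0#                   ∎

  gaussian-! : ∀ k l → gaussian (k ℕ.+ l) k * (factorial k * factorial l) ≈ factorial (k ℕ.+ l)
  gaussian-! zero l = trans (*-identityˡ _) (*-identityˡ _)
  gaussian-! (suc k) zero = begin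
    (g + e * gaussian (k ℕ.+ 0) (suc k)) * (b * f * 1#)
      ≈⟨ *-cong (+-congˡ (trans (*-congˡ (gaussian-> k+0<1+k)) (zeroʳ _))) refl ⟩
    (g + 0#) * (b * f * 1#)
      ≈⟨ *-congʳ (+-identityʳ g) ⟩
    g * (b * f * 1#)
      ≈⟨ solve 4 (λ g b f o → g :* (b :* f :* o) := b :* (g :* (f :* o))) refl g b f 1# ⟩
    b * (g * (f * 1#))
      ≈⟨ *-congˡ (gaussian-! k zero) ⟩
    b * factorial (k ℕ.+ 0)
      ≡⟨ ≡.cong (λ n → bracket (suc n) * factorial (k ℕ.+ 0)) (≡.sym (ℕ.+-identityʳ k)) ⟩
    factorial (suc k ℕ.+ 0) ∎
    where
    g = gaussian (k ℕ.+ 0) k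
    e = p ^ suc k
    b = bracket (suc k)
    f = factorial k
    k+0<1+k : k ℕ.+ 0 ℕ.< suc k
    k+0<1+k rewrite ℕ.+-identityʳ k = ℕ.s≤s ℕ.≤-refl
  gaussian-! (suc k) (suc l) = begin
    (g + e * g′) * ((b * f) * (d * f′))
      ≈⟨ solve 7 (λ g e g′ b f d f′ → (g :+ e :* g′) :* ((b :* f) :* (d :* f′)) := b :* (g :* (f :* (d :* f′))) :+ e :* d :* (g′ :* ((b :* f) :* f′))) refl g e g′ b f d f′ ⟩
    b * (g * (f * (d * f′))) + e * d * (g′ * ((b * f) * f′))
      ≈⟨ +-cong (*-congˡ (gaussian-! k (suc l))) (*-congˡ step) ⟩
    b * F + e * d * F
      ≈⟨ distribʳ F b (e * d) ⟨
    (b + e * d) * F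
      ≈⟨ *-congʳ (bracket-+ (suc k) (suc l)) ⟨
    factorial (suc k ℕ.+ suc l) ∎
    where
    g  = gaussian (k ℕ.+ suc l) k
    g′ = gaussian (k ℕ.+ suc l) (suc k)
    e  = p ^ suc k
    b  = bracket (suc k)
    f  = factorial k
    d  = bracket (suc l)
    f′ = factorial l
    F  = factorial (k ℕ.+ suc l)
    step : g′ * ((b * f) * f′) ≈ F
    step = ≡.subst (λ n → gaussian n (suc k) * (factorial (suc k) * factorial l) ≈ factorial n)
                   (≡.sym (ℕ.+-suc k l)) (gaussian-! (suc k) l)

-- For the complex numbers, # is ≠, and the last argument is supplied by excluded middle.
module QNumbers
  {c ℓ₁ ℓ₂} (K : HeytingField c ℓ₁ ℓ₂) (q : HeytingField.Carrier K)
  (q#0 : HeytingField._#_ K q (HeytingField.0# K))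
  (q#?1 : Dec (HeytingField._#_ K q (HeytingField.1# K)))
  where

  open HeytingField K hiding (zero)

  private
    commutativeRing : CommutativeRing c ℓ₁
    commutativeRing = HeytingCommutativeRing.commutativeRing heytingCommutativeRing

  open CommutativeRing commutativeRing public
    using (semiring; commutativeSemiring; +-monoid)
  open SemiringExp semiring public using (_^_)
  open RawSemiringDefs (Semiring.rawSemiring semiring) using (product) renaming (_×_ to _·_)
  open MonoidSum +-monoid public using (sum; sum-syntax; sum⁺-syntax)

  infixl 10 product-syntax

  product-syntax : ∀ n → Vector Carrier n → Carrier
  product-syntax _ = product

  syntax product-syntax n (λ i → x) = ∏[ i < n ] x

  fromℤ : ℤ → Carrier
  fromℤ (+ n)    = n · 1#
  fromℤ -[1+ n ] = - (suc n · 1#)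

  -- #⇒invertible q#0 is an inverse of q - 0#, hence of q.
  q⁻¹ : Carrier
  q⁻¹ = proj₁ (#⇒invertible q#0)

  q^_ : ℤ → Carrier
  q^ (+ n)    = q ^ n
  q^ -[1+ n ] = q⁻¹ ^ suc n

  infix 9 q^_

  -- In the second case q ≈ 1#, by tightness.
  qNumber : Dec (q # 1#) → ℤ → Carrier
  qNumber (yes q#1) x = (q^ x - 1#) * proj₁ (#⇒invertible q#1)
  qNumber (no _)    x = fromℤ x

  [_]q : ℤ → Carrier
  [ x ]q = qNumber q#?1 x

  gaussian : Carrier → ℕ → ℕ → Carrier
  gaussian = Gaussian.gaussian commutativeSemiring

  module Stirling (s : ℕ) (h : Carrier) where

    S : ℕ → ℤ → Carrier
    S n       -[1+ k ]    = 0#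
    S zero    (+ zero)    = 1#
    S zero    (+ (suc k)) = 0#
    S (suc n) (+ zero)    = 0#
    S (suc n) (+ (suc k)) =
        q^ (+ s ℤ.* + n ℤ.- (+ s ℤ.- + 1) ℤ.* + k) * S n (+ k)
      + h * [ + s ℤ.* + n ℤ.- (+ s ℤ.- + 1) ℤ.* + suc k ]q * S n (+ suc k)

    B : ℕ → Carrier
    B n = ∑[ k ≤ n ] S n (+ toℕ k)

-- Write a(n,k) = sn − (s−1)k, so that S[n+1,k] = q^a(n,k−1) S[n,k−1] + h [a(n,k)] S[n,k] for
-- every integer k.  The first identity follows by induction on n: with x = a(m,j), both
-- a(n+m,k) = x + s(n−r) + a(r,k−j) and [x+y] = [x] + q^x [y] split the recurrence for
-- S[n+m+1,k] into one contribution to the index r+1 and one to the index r, and the q-Pascal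
-- rule G(n+1,r+1) = p^(n−r) G(n,r) + G(n,r+1) for p = q^s recombines them.  Summing over k
-- yields the second identity.

module Submission where

open import Defs
open import Algebra.Apartness using (HeytingField)
open import Algebra.Bundles using (CommutativeRing; CommutativeSemiring; Monoid)
open import Data.Fin.Base using (Fin; toℕ)
import Data.Fin.Properties as Fin
open import Data.Integer.Base as ℤ using (ℤ; +_; -[1+_])
import Data.Integer.Properties as ℤ
open import Data.Integer.Tactic.RingSolver using (solve-∀)
open import Data.Nat.Base as ℕ using (ℕ; zero; suc; _∸_; z≤n; s≤s)
import Data.Nat.Properties as ℕ
open import Data.Product.Base using (_×_; _,_; proj₁; proj₂)
open import Data.Sum.Base using (inj₁; inj₂)
open import Relation.Binary.PropositionalEquality.Core as ≡ using (_≡_)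
open import Relation.Nullary.Decidable.Core using (Dec; yes; no)
import Algebra.Properties.CommutativeSemiring.Exp as CommutativeSemiringExp
import Algebra.Properties.Monoid.Sum as MonoidSum
import Algebra.Properties.Ring as RingProperties
import Algebra.Properties.Semiring.Exp as SemiringExp
import Algebra.Properties.Semiring.Sum as SemiringSum
import Algebra.Solver.Ring.NaturalCoefficients.Default as RingSolver
import Relation.Binary.Reasoning.Setoid as ≈-Reasoning

-- Auxiliary facts: integers, sums in a monoid, maps out of the integers.

suc-minus-suc : ∀ i j → + 1 ℤ.+ i ℤ.- (+ 1 ℤ.+ j) ≡ i ℤ.- j
suc-minus-suc = solve-∀

module _ {c ℓ} (M : Monoid c ℓ) where

  open Monoid M
  open MonoidSum M using (sum)
  open ≈-Reasoning setoid

  -- `sum` unfolds at its first term, while the proof also has to split off the last one. Working in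
  -- an arbitrary monoid covers sums and products alike.
  sum-snoc : ∀ (f : ℕ → Carrier) n →
             sum {suc n} (λ i → f (toℕ i)) ≈ sum {n} (λ i → f (toℕ i)) ∙ f n
  sum-snoc f zero    = trans (identityʳ _) (sym (identityˡ _))
  sum-snoc f (suc n) = trans (∙-congˡ (sum-snoc (λ i → f (suc i)) n)) (sym (assoc _ _ _))

  module _ (f : ℤ → Carrier) {u v : Carrier} (v∙u≈ε : v ∙ u ≈ ε)
           (f-zero : f (+ 0) ≈ ε) (f-suc : ∀ x → f (ℤ.suc x) ≈ u ∙ f x) where

    ℤ-pred : ∀ x → f (ℤ.pred x) ≈ v ∙ f x
    ℤ-pred x = begin
      f (ℤ.pred x)                  ≈⟨ identityˡ _ ⟨
      ε ∙ f (ℤ.pred x)              ≈⟨ ∙-congʳ v∙u≈ε ⟨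
      v ∙ u ∙ f (ℤ.pred x)          ≈⟨ assoc _ _ _ ⟩
      v ∙ (u ∙ f (ℤ.pred x))        ≈⟨ ∙-congˡ (f-suc _) ⟨
      v ∙ f (ℤ.suc (ℤ.pred x))      ≡⟨ ≡.cong (λ y → v ∙ f y) (ℤ.suc-pred x) ⟩
      v ∙ f x                       ∎

    -- Induction on `x`, away from 0 in both directions: a step up multiplies by `u`, a step down by
    -- its left inverse `v`. It is used for the powers of `q` in the multiplicative monoid and for
    -- `fromℤ` in the additive one.
    ℤ-homo : ∀ x y → f (x ℤ.+ y) ≈ f x ∙ f y
    ℤ-homo (+ zero) y = begin
      f (+ 0 ℤ.+ y)  ≡⟨ ≡.cong f (ℤ.+-identityˡ y) ⟩
      f y            ≈⟨ identityˡ _ ⟨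
      ε ∙ f y        ≈⟨ ∙-congʳ f-zero ⟨
      f (+ 0) ∙ f y  ∎
    ℤ-homo (+ suc n) y = begin
      f (+ suc n ℤ.+ y)          ≡⟨ ≡.cong f (ℤ.+-assoc (+ 1) (+ n) y) ⟩
      f (ℤ.suc (+ n ℤ.+ y))      ≈⟨ f-suc _ ⟩
      u ∙ f (+ n ℤ.+ y)          ≈⟨ ∙-congˡ (ℤ-homo (+ n) y) ⟩
      u ∙ (f (+ n) ∙ f y)        ≈⟨ assoc _ _ _ ⟨
      u ∙ f (+ n) ∙ f y          ≈⟨ ∙-congʳ (f-suc (+ n)) ⟨
      f (+ suc n) ∙ f y          ∎
    ℤ-homo -[1+ zero ] y = begin
      f (ℤ.pred y)               ≈⟨ ℤ-pred y ⟩
      v ∙ f y                    ≈⟨ ∙-congʳ (identityʳ v) ⟨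
      v ∙ ε ∙ f y                ≈⟨ ∙-congʳ (∙-congˡ f-zero) ⟨
      v ∙ f (+ 0) ∙ f y          ≈⟨ ∙-congʳ (ℤ-pred (+ 0)) ⟨
      f -[1+ 0 ] ∙ f y           ∎
    ℤ-homo -[1+ suc n ] y = begin
      f (-[1+ suc n ] ℤ.+ y)          ≡⟨ ≡.cong f (ℤ.+-assoc -[1+ 0 ] -[1+ n ] y) ⟩
      f (ℤ.pred (-[1+ n ] ℤ.+ y))     ≈⟨ ℤ-pred _ ⟩
      v ∙ f (-[1+ n ] ℤ.+ y)          ≈⟨ ∙-congˡ (ℤ-homo -[1+ n ] y) ⟩
      v ∙ (f -[1+ n ] ∙ f y)          ≈⟨ assoc _ _ _ ⟨
      v ∙ f -[1+ n ] ∙ f y            ≈⟨ ∙-congʳ (ℤ-pred -[1+ n ]) ⟨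
      f -[1+ suc n ] ∙ f y            ∎

-- The second Pascal rule for Gaussian coefficients.

module _ {c ℓ} (R : CommutativeSemiring c ℓ) (p : CommutativeSemiring.Carrier R) where

  open CommutativeSemiring R hiding (zero)
  open SemiringExp semiring using (_^_)
  open Gaussian R p using (gaussian; gaussian->)
  open ≈-Reasoning setoid
  open RingSolver R using (solve; _:=_; _:+_; _:*_)

  -- The mirror image of the defining rule, with the power of `p` on the other summand. Unfold the
  -- definition once, apply the mirrored rule to both summands by induction, and fold the definition
  -- back. The bound on `k` makes the truncated exponent an honest difference.
  gaussian-pascal : ∀ {n k} → k ℕ.≤ n →
                    gaussian (suc n) (suc k) ≈ p ^ (n ∸ k) * gaussian n k + gaussian n (suc k)
  gaussian-pascal {zero}  {zero}  _         = +-cong (sym (*-identityˡ 1#)) (zeroʳ _)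
  gaussian-pascal {suc n} {zero}  _         = begin
    1# + p ^ 1 * gaussian (suc n) 1
      ≈⟨ +-congˡ (*-congˡ (gaussian-pascal {n} z≤n)) ⟩
    1# + p ^ 1 * (p ^ n * 1# + gaussian n 1)
      ≈⟨ solve 4 (λ o p e g → o :+ (p :* o) :* (e :* o :+ g)
           := (p :* o) :* e :* o :+ (o :+ (p :* o) :* g))
           refl 1# p (p ^ n) (gaussian n 1) ⟩
    p ^ 1 * p ^ n * 1# + gaussian (suc n) 1
      ≈⟨ +-congʳ (*-congʳ (*-congʳ (*-identityʳ p))) ⟩
    p ^ suc n * 1# + gaussian (suc n) 1 ∎
  gaussian-pascal {suc n} {suc k} (s≤s k≤n) = begin
    gaussian (suc n) (suc k) + p ^ (2 ℕ.+ k) * gaussian (suc n) (2 ℕ.+ k)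
      ≈⟨ +-cong (gaussian-pascal k≤n) scaled ⟩
    (e * g + g′) + (e * d * g′ + p ^ (2 ℕ.+ k) * g″)
      ≈⟨ solve 5 (λ e g g′ d f → (e :* g :+ g′) :+ (e :* d :* g′ :+ f)
           := e :* (g :+ d :* g′) :+ (g′ :+ f))
           refl e g g′ d (p ^ (2 ℕ.+ k) * g″) ⟩
    e * (g + d * g′) + (g′ + p ^ (2 ℕ.+ k) * g″) ∎
    where
    e  = p ^ (n ∸ k)
    d  = p ^ suc k
    g  = gaussian n k
    g′ = gaussian n (suc k)
    g″ = gaussian n (2 ℕ.+ k)

    scaled : p ^ (2 ℕ.+ k) * gaussian (suc n) (2 ℕ.+ k) ≈ e * d * g′ + p ^ (2 ℕ.+ k) * g″
    scaled with ℕ.m≤n⇒m<n∨m≡n k≤n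
    ... | inj₁ k<n = begin
      p ^ (2 ℕ.+ k) * gaussian (suc n) (2 ℕ.+ k)
        ≈⟨ *-congˡ (gaussian-pascal k<n) ⟩
      p ^ (2 ℕ.+ k) * (p ^ (n ∸ suc k) * g′ + g″)
        ≈⟨ solve 5 (λ p d f g′ g″ → p :* d :* (f :* g′ :+ g″) := p :* f :* d :* g′ :+ p :* d :* g″)
             refl p d (p ^ (n ∸ suc k)) g′ g″ ⟩
      p ^ suc (n ∸ suc k) * d * g′ + p ^ (2 ℕ.+ k) * g″
        -- As k < n, the factor `p` split off from p^(k+2) raises the exponent n - (k+1) to n - k.
        ≡⟨ ≡.cong (λ l → p ^ l * d * g′ + p ^ (2 ℕ.+ k) * g″) (ℕ.+-∸-assoc 1 k<n) ⟨
      e * d * g′ + p ^ (2 ℕ.+ k) * g″ ∎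
    -- For k = n the induction hypothesis is out of range, but `g′`, `g″` and the coefficient on the
    -- left all have a lower index exceeding the upper one, so they vanish.
    ... | inj₂ ≡.refl = begin
      p ^ (2 ℕ.+ n) * gaussian (suc n) (2 ℕ.+ n)
        ≈⟨ *-congˡ (trans (gaussian-> (ℕ.n<1+n (suc n))) (sym (gaussian-> (ℕ.m<n⇒m<1+n (ℕ.n<1+n n))))) ⟩
      p ^ (2 ℕ.+ n) * g″
        ≈⟨ +-identityˡ _ ⟨
      0# + p ^ (2 ℕ.+ n) * g″
        ≈⟨ +-congʳ (trans (*-congˡ (gaussian-> (ℕ.n<1+n n))) (zeroʳ _)) ⟨
      e * d * g′ + p ^ (2 ℕ.+ n) * g″ ∎

-- Integer powers of q and q-numbers.

module _
  {c ℓ₁ ℓ₂} (K : HeytingField c ℓ₁ ℓ₂) (q : HeytingField.Carrier K)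
  (q#0 : HeytingField._#_ K q (HeytingField.0# K))
  (q#?1 : Dec (HeytingField._#_ K q (HeytingField.1# K)))
  where

  open HeytingField K hiding (zero)
  open QNumbers K q q#0 q#?1 hiding (semiring; commutativeSemiring; sum; sum-syntax; sum⁺-syntax)
  private
    commutativeRing : CommutativeRing c ℓ₁
    commutativeRing = record { isCommutativeRing = isCommutativeRing }
  open CommutativeRing commutativeRing using (ring; semiring; commutativeSemiring; *-monoid)
  open RingProperties ring using (-0#≈0#; -‿+-comm)
  open SemiringSum semiring
  open CommutativeSemiringExp commutativeSemiring using (^-assocʳ)
  open ≈-Reasoning setoid
  open RingSolver commutativeSemiring using (solve; _:=_; _:+_; _:*_)

  q⁻¹*q≈1 : q⁻¹ * q ≈ 1#
  q⁻¹*q≈1 = begin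
    q⁻¹ * q          ≈⟨ *-congˡ (trans (+-congˡ -0#≈0#) (+-identityʳ q)) ⟨
    q⁻¹ * (q - 0#)   ≈⟨ proj₁ (proj₂ (#⇒invertible q#0)) ⟩
    1#               ∎

  q^-suc : ∀ x → q^ (ℤ.suc x) ≈ q * q^ x
  q^-suc (+ n)        = refl
  q^-suc -[1+ n ] = begin
    q^ (ℤ.suc -[1+ n ])    ≈⟨ at n ⟩
    q⁻¹ ^ n                ≈⟨ *-identityˡ _ ⟨
    1# * q⁻¹ ^ n           ≈⟨ *-congʳ (trans (*-comm q q⁻¹) q⁻¹*q≈1) ⟨
    q * q⁻¹ * q⁻¹ ^ n      ≈⟨ *-assoc _ _ _ ⟩
    q * q⁻¹ ^ suc n        ∎
    where
    at : ∀ n → q^ (ℤ.suc -[1+ n ]) ≈ q⁻¹ ^ n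
    at zero    = refl
    at (suc n) = refl

  q^-homo : ∀ x y → q^ (x ℤ.+ y) ≈ q^ x * q^ y
  q^-homo = ℤ-homo *-monoid q^_ q⁻¹*q≈1 refl q^-suc

  -- Turns a shift by sl in an exponent of `q` into the factor p^l, p = q^s, that the Pascal rule
  -- absorbs.
  q^-* : ∀ m n → q^ (+ m ℤ.* + n) ≈ (q ^ m) ^ n
  q^-* m n = begin
    q^ (+ m ℤ.* + n)  ≡⟨ ≡.cong q^_ (ℤ.pos-* m n) ⟨
    q ^ (m ℕ.* n)     ≈⟨ ^-assocʳ q m n ⟨
    (q ^ m) ^ n       ∎

  fromℤ-suc : ∀ x → fromℤ (ℤ.suc x) ≈ 1# + fromℤ x
  fromℤ-suc (+ n)    = refl
  fromℤ-suc -[1+ n ] = begin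
    fromℤ (ℤ.suc -[1+ n ])        ≈⟨ at n ⟩
    - fromℤ (+ n)                 ≈⟨ +-identityˡ _ ⟨
    0# - fromℤ (+ n)              ≈⟨ +-congʳ (-‿inverseʳ 1#) ⟨
    1# - 1# - fromℤ (+ n)         ≈⟨ +-assoc _ _ _ ⟩
    1# + (- 1# - fromℤ (+ n))     ≈⟨ +-congˡ (-‿+-comm _ _) ⟩
    1# - (1# + fromℤ (+ n))       ∎
    where
    at : ∀ n → fromℤ (ℤ.suc -[1+ n ]) ≈ - fromℤ (+ n)
    at zero    = sym -0#≈0#
    at (suc n) = refl

  fromℤ-homo : ∀ x y → fromℤ (x ℤ.+ y) ≈ fromℤ x + fromℤ y
  fromℤ-homo = ℤ-homo +-monoid fromℤ (-‿inverseˡ 1#) refl fromℤ-suc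

  ^-one : ∀ {x} n → x ≈ 1# → x ^ n ≈ 1#
  ^-one zero    x≈1 = refl
  ^-one (suc n) x≈1 = trans (*-cong x≈1 (^-one n x≈1)) (*-identityˡ 1#)

  q^-one : q ≈ 1# → ∀ x → q^ x ≈ 1#
  q^-one q≈1 (+ n)    = ^-one n q≈1
  q^-one q≈1 -[1+ n ] = ^-one (suc n) (begin
    q⁻¹       ≈⟨ *-identityʳ q⁻¹ ⟨
    q⁻¹ * 1#  ≈⟨ *-congˡ q≈1 ⟨
    q⁻¹ * q   ≈⟨ q⁻¹*q≈1 ⟩
    1#        ∎)

  -- For q ≠ 1 this is q^(x+y) - 1 = (q^x - 1) + q^x (q^y - 1), divided by q - 1. For q = 1 the
  -- factor q^x is 1, and what remains is additivity of `fromℤ`.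
  qNumber-homo : ∀ d x y → qNumber d (x ℤ.+ y) ≈ qNumber d x + q^ x * qNumber d y
  qNumber-homo (yes q#1) x y = begin
    (q^ (x ℤ.+ y) - 1#) * i
      ≈⟨ *-congʳ (+-congʳ (q^-homo x y)) ⟩
    (q^ x * q^ y - 1#) * i
      ≈⟨ *-congʳ (+-identityʳ _) ⟨
    (q^ x * q^ y - 1# + 0#) * i
      -- A zero term q^x (1 - 1) is inserted because the semiring solver treats -1 as an atom and
      -- cannot cancel it against 1.
      ≈⟨ *-congʳ (+-congˡ (trans (*-congˡ (-‿inverseʳ 1#)) (zeroʳ (q^ x)))) ⟨
    (q^ x * q^ y - 1# + q^ x * (1# - 1#)) * i
      ≈⟨ solve 5 (λ a b n o i → (a :* b :+ n :+ a :* (o :+ n)) :* i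
           := (a :* o :+ n) :* i :+ a :* ((b :+ n) :* i))
           refl (q^ x) (q^ y) (- 1#) 1# i ⟩
    (q^ x * 1# - 1#) * i + q^ x * ((q^ y - 1#) * i)
      ≈⟨ +-congʳ (*-congʳ (+-congʳ (*-identityʳ _))) ⟩
    (q^ x - 1#) * i + q^ x * ((q^ y - 1#) * i) ∎
    where
    i = proj₁ (#⇒invertible q#1)
  qNumber-homo (no ¬q#1) x y = begin
    fromℤ (x ℤ.+ y)            ≈⟨ fromℤ-homo x y ⟩
    fromℤ x + fromℤ y          ≈⟨ +-congˡ (*-identityˡ _) ⟨
    fromℤ x + 1# * fromℤ y     ≈⟨ +-congˡ (*-congʳ (q^-one (proj₁ (tight q 1#) ¬q#1) x)) ⟨
    fromℤ x + q^ x * fromℤ y   ∎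

  qNumber-zero : ∀ d → qNumber d (+ 0) ≈ 0#
  qNumber-zero (yes _) = trans (*-congʳ (-‿inverseʳ 1#)) (zeroˡ _)
  qNumber-zero (no  _) = refl

  -- The generalized Stirling numbers: recurrence, support and sums.

  module _ (s : ℕ) (h : Carrier) where

    open Stirling s h

    a : ℕ → ℤ → ℤ
    a n k = + s ℤ.* + n ℤ.- (+ s ℤ.- + 1) ℤ.* k

    -- For k < 0 every term is zero. For k = 0 the first summand has index -1, and the second
    -- vanishes because S[n,0] = 0 when n > 0 and because its coefficient contains [0] when n = 0.
    -- Having all integers k available spares later inductions any boundary cases.
    S-suc : ∀ n k → S (suc n) k ≈ q^ (a n (k ℤ.- + 1)) * S n (k ℤ.- + 1) + h * [ a n k ]q * S n k
    S-suc n (+ suc k) = refl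
    S-suc n -[1+ k ]  = sym (trans (+-cong (zeroʳ _) (zeroʳ _)) (+-identityˡ 0#))
    S-suc n (+ zero)  = sym (trans (+-cong (zeroʳ _) (at n)) (+-identityˡ 0#))
      where
      at : ∀ n → h * [ a n (+ 0) ]q * S n (+ 0) ≈ 0#
      at zero    = begin
        h * [ a 0 (+ 0) ]q * 1#  ≡⟨ ≡.cong (λ x → h * [ x ]q * 1#) (a-zero (+ s)) ⟩
        h * [ + 0 ]q * 1#        ≈⟨ *-congʳ (trans (*-congˡ (qNumber-zero q#?1)) (zeroʳ h)) ⟩
        0# * 1#                  ≈⟨ zeroˡ 1# ⟩
        0#                       ∎
        where
        a-zero : ∀ s → s ℤ.* + 0 ℤ.- (s ℤ.- + 1) ℤ.* + 0 ≡ + 0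
        a-zero = solve-∀
      at (suc n) = zeroʳ _

    S-> : ∀ {n k} → n ℕ.< k → S n (+ k) ≈ 0#
    S-> {zero}  {suc k} _         = refl
    S-> {suc n} {suc k} (s≤s n<k) = trans
      (+-cong (trans (*-congˡ (S-> n<k)) (zeroʳ _))
              (trans (*-congˡ (S-> (ℕ.m<n⇒m<1+n n<k))) (zeroʳ _)))
      (+-identityˡ 0#)

    -- The terms with k < j have a negative index and those with k > r + j exceed the support of
    -- S[r,·], so the range up to `N` contains the whole shifted support.
    ∑-S-shift : ∀ {r N} j → r ℕ.+ j ℕ.≤ N → ∑[ k ≤ N ] S r (+ toℕ k ℤ.- + j) ≈ B r
    ∑-S-shift {r} {N} zero r+0≤N = begin
      ∑[ k ≤ N ] S r (+ toℕ k ℤ.- + 0)  ≡⟨ sum-cong-≗ {suc N} (λ k → ≡.cong (S r) (ℤ.+-identityʳ (+ toℕ k))) ⟩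
      ∑[ k ≤ N ] S r (+ toℕ k)          ≈⟨ at (ℕ.≤⇒≤′ (≡.subst (ℕ._≤ N) (ℕ.+-identityʳ r) r+0≤N)) ⟩
      B r                               ∎
      where
      at : ∀ {N} → r ℕ.≤′ N → ∑[ k ≤ N ] S r (+ toℕ k) ≈ B r
      at ℕ.≤′-refl           = refl
      at {suc N} (ℕ.≤′-step r≤N) = begin
        ∑[ k ≤ suc N ] S r (+ toℕ k)                ≈⟨ sum-snoc +-monoid (λ k → S r (+ k)) (suc N) ⟩
        ∑[ k ≤ N ] S r (+ toℕ k) + S r (+ suc N)    ≈⟨ +-cong (at r≤N) (S-> (s≤s (ℕ.≤′⇒≤ r≤N))) ⟩
        B r + 0#                                    ≈⟨ +-identityʳ _ ⟩
        B r                                         ∎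
    ∑-S-shift {r} {zero}  (suc j) r+1+j≤0 with () ← ≡.subst (ℕ._≤ 0) (ℕ.+-suc r j) r+1+j≤0
    ∑-S-shift {r} {suc N} (suc j) r+1+j≤1+N = begin
      -- The term k = 0 has index -(j+1), so it is `0#` by definition.
      0# + ∑[ k ≤ N ] S r (+ suc (toℕ k) ℤ.- + suc j)
        ≈⟨ +-identityˡ _ ⟩
      ∑[ k ≤ N ] S r (+ suc (toℕ k) ℤ.- + suc j)
        ≡⟨ sum-cong-≗ {suc N} (λ k → ≡.cong (S r) (suc-minus-suc (+ toℕ k) (+ j))) ⟩
      ∑[ k ≤ N ] S r (+ toℕ k ℤ.- + j)
        ≈⟨ ∑-S-shift j (ℕ.s≤s⁻¹ (≡.subst (ℕ._≤ suc N) (ℕ.+-suc r j) r+1+j≤1+N)) ⟩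
      B r ∎

    -- S[0,k-j] is the Kronecker delta of j and k, so the sum selects one value of `f`. If `k` lies
    -- outside the range, the sum is zero, and the hypothesis says that so is that value.
    ∑-*-S-zero : ∀ M (f : ℕ → Carrier) → (∀ {j} → M ℕ.≤ j → f j ≈ 0#) →
                 ∀ k → ∑[ j < M ] (f (toℕ j) * S 0 (+ k ℤ.- + toℕ j)) ≈ f k
    ∑-*-S-zero zero    f f≈0 k    = sym (f≈0 z≤n)
    ∑-*-S-zero (suc M) f f≈0 zero = begin
      f 0 * 1# + ∑[ j < M ] (f (suc (toℕ j)) * 0#)
        ≈⟨ +-cong (*-identityʳ _) (trans (sum-cong-≋ {M} (λ j → zeroʳ _)) (sum-replicate-zero M)) ⟩
      f 0 + 0#
        ≈⟨ +-identityʳ _ ⟩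
      f 0 ∎
    ∑-*-S-zero (suc M) f f≈0 (suc k) = begin
      f 0 * 0# + ∑[ j < M ] (f (suc (toℕ j)) * S 0 (+ suc k ℤ.- + suc (toℕ j)))
        ≈⟨ +-congʳ (zeroʳ _) ⟩
      0# + ∑[ j < M ] (f (suc (toℕ j)) * S 0 (+ suc k ℤ.- + suc (toℕ j)))
        ≈⟨ +-identityˡ _ ⟩
      ∑[ j < M ] (f (suc (toℕ j)) * S 0 (+ suc k ℤ.- + suc (toℕ j)))
        ≡⟨ sum-cong-≗ {M} (λ j → ≡.cong (λ x → f (suc (toℕ j)) * S 0 x) (suc-minus-suc (+ k) (+ toℕ j))) ⟩
      ∑[ j < M ] (f (suc (toℕ j)) * S 0 (+ k ℤ.- + toℕ j))
        ≈⟨ ∑-*-S-zero M (λ j → f (suc j)) (λ M≤j → f≈0 (s≤s M≤j)) k ⟩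
      f (suc k) ∎

    -- Rising q-factorials with step s, and the inner sum over r.

    P : ℤ → ℕ → Carrier
    P x l = ∏[ i < l ] [ x ℤ.+ + s ℤ.* + toℕ i ]q

    P-suc : ∀ x l → P x (suc l) ≈ P x l * [ x ℤ.+ + s ℤ.* + l ]q
    P-suc x l = sum-snoc *-monoid (λ i → [ x ℤ.+ + s ℤ.* + i ]q) l

    p : Carrier
    p = q ^ s

    module Inner (x : ℤ) where

      -- The Gaussian coefficient is a parameter g, as the q-Pascal rule splits only this factor.
      W : Carrier → ℕ → ℕ → ℤ → Carrier
      W g r l k = h ^ l * q^ (+ r ℤ.* x) * g * S r k * P x l

      -- The sum over r in the theorem for a fixed j, without S[m,j]: x is j(1−s)+sm and k is k−j.
      T : ℕ → ℤ → Carrier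
      T n k = ∑[ r ≤ n ] W (gaussian p n (toℕ r)) (toℕ r) (n ∸ toℕ r) k

      T-zero : ∀ k → T 0 k ≈ S 0 k
      T-zero k = begin
        1# * q^ (+ 0 ℤ.* x) * 1# * S 0 k * 1# + 0#  ≈⟨ +-identityʳ _ ⟩
        1# * q^ (+ 0 ℤ.* x) * 1# * S 0 k * 1#       ≈⟨ *-identityʳ _ ⟩
        1# * q^ (+ 0 ℤ.* x) * 1# * S 0 k            ≈⟨ *-congʳ (*-identityʳ _) ⟩
        1# * q^ (+ 0 ℤ.* x) * S 0 k                 ≈⟨ *-congʳ (*-identityˡ _) ⟩
        q^ (+ 0 ℤ.* x) * S 0 k                      ≡⟨ ≡.cong (λ y → q^ y * S 0 k) (ℤ.*-zeroˡ x) ⟩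
        1# * S 0 k                                  ≈⟨ *-identityˡ _ ⟩
        S 0 k                                       ∎

      W-zero : ∀ {g} r l k → g ≈ 0# → W g r l k ≈ 0#
      W-zero r l k g≈0 = trans (*-congʳ (trans (*-congʳ (trans (*-congˡ g≈0) (zeroʳ _))) (zeroˡ _))) (zeroˡ _)

      W-+ : ∀ g g′ r l k → W (g + g′) r l k ≈ W g r l k + W g′ r l k
      W-+ g g′ r l k = solve 6 (λ a b g g′ c d → a :* b :* (g :+ g′) :* c :* d
           := a :* b :* g :* c :* d :+ a :* b :* g′ :* c :* d)
           refl (h ^ l) (q^ (+ r ℤ.* x)) g g′ (S r k) (P x l)

      W-cong : ∀ {g g′} r l k → g ≈ g′ → W g r l k ≈ W g′ r l k
      W-cong r l k g≈g′ = *-congʳ (*-congʳ (*-congˡ g≈g′))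

      -- With y = x + sl, the argument x + a(r+l,k) equals y + a(r,k), so its q-number is [y] + q^y
      -- [a(r,k)]. The part with [y] supplies the next factor of `P` and one more `h`. All other
      -- terms share q^y = q^x p^l and assemble into the recurrence for S[r+1,k]; q^x then joins the
      -- power of `q`, and p^l joins `g`.
      W-step : ∀ g r l k →
               q^ (x ℤ.+ a (r ℕ.+ l) (k ℤ.- + 1)) * W g r l (k ℤ.- + 1)
                 + h * [ x ℤ.+ a (r ℕ.+ l) k ]q * W g r l k
               ≈ W g r (suc l) k + W (p ^ l * g) (suc r) l k
      W-step g r l k = begin
        q^ (x ℤ.+ a (r ℕ.+ l) k⁻) * w k⁻ + h * [ x ℤ.+ a (r ℕ.+ l) k ]q * w k
          ≡⟨ ≡.cong₂ (λ y z → q^ y * w k⁻ + h * [ z ]q * w k) (split k⁻) (split k) ⟩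
        q^ (y ℤ.+ a r k⁻) * w k⁻ + h * [ y ℤ.+ a r k ]q * w k
          ≈⟨ +-cong (*-congʳ (trans (q^-homo y _) (*-congʳ q^y)))
                    (*-congʳ (*-congˡ (trans (qNumber-homo q#?1 y _) (+-congˡ (*-congʳ q^y))))) ⟩
        X * p ^ l * α * w k⁻ + h * ([ y ]q + X * p ^ l * β) * w k
          ≈⟨ solve 12 (λ h X pl α β γ H Q g σ′ σ R →
               X :* pl :* α :* (H :* Q :* g :* σ′ :* R) :+ h :* (γ :+ X :* pl :* β) :* (H :* Q :* g :* σ :* R)
               := h :* H :* Q :* g :* σ :* (R :* γ) :+ H :* (X :* Q) :* (pl :* g) :* (α :* σ′ :+ h :* β :* σ) :* R)
               refl h X (p ^ l) α β [ y ]q (h ^ l) (q^ (+ r ℤ.* x)) g (S r k⁻) (S r k) (P x l) ⟩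
        h * h ^ l * q^ (+ r ℤ.* x) * g * S r k * (P x l * [ y ]q)
          + h ^ l * (X * q^ (+ r ℤ.* x)) * (p ^ l * g) * (α * S r k⁻ + h * β * S r k) * P x l
          ≈⟨ +-cong (*-congˡ (P-suc x l)) (*-congʳ (*-cong (*-congʳ (*-congˡ q^[1+r]x)) (S-suc r k))) ⟨
        W g r (suc l) k + W (p ^ l * g) (suc r) l k ∎
        where
        k⁻ = k ℤ.- + 1
        w  = W g r l
        y  = x ℤ.+ + s ℤ.* + l
        X  = q^ x
        α  = q^ (a r k⁻)
        β  = [ a r k ]q

        split : ∀ k → x ℤ.+ a (r ℕ.+ l) k ≡ y ℤ.+ a r k
        split k = at (+ s) x (+ r) (+ l) k
          where
          at : ∀ s x r l k → x ℤ.+ (s ℤ.* (r ℤ.+ l) ℤ.- (s ℤ.- + 1) ℤ.* k)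
                           ≡ x ℤ.+ s ℤ.* l ℤ.+ (s ℤ.* r ℤ.- (s ℤ.- + 1) ℤ.* k)
          at = solve-∀

        q^y : q^ y ≈ X * p ^ l
        q^y = trans (q^-homo x _) (*-congˡ (q^-* s l))

        q^[1+r]x : q^ (+ suc r ℤ.* x) ≈ X * q^ (+ r ℤ.* x)
        q^[1+r]x = begin
          q^ (+ suc r ℤ.* x)      ≡⟨ ≡.cong q^_ (ℤ.suc-* (+ r) x) ⟩
          q^ (x ℤ.+ + r ℤ.* x)    ≈⟨ q^-homo x _ ⟩
          X * q^ (+ r ℤ.* x)      ∎

      -- Each summand splits by `W-step` into a part `C` that keeps the index r and a part `A` that
      -- moves to r + 1. Shifting `C` by one aligns the two for the Pascal rule.
      T-suc : ∀ n k → T (suc n) k ≈ q^ (x ℤ.+ a n (k ℤ.- + 1)) * T n (k ℤ.- + 1)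
                                    + h * [ x ℤ.+ a n k ]q * T n k
      T-suc n k = sym (begin
        X * T n k⁻ + Y * T n k
          ≈⟨ +-cong (*-distribˡ-sum {suc n} X (λ r → V (toℕ r) k⁻))
                    (*-distribˡ-sum {suc n} Y (λ r → V (toℕ r) k)) ⟩
        ∑[ r ≤ n ] (X * V (toℕ r) k⁻) + ∑[ r ≤ n ] (Y * V (toℕ r) k)
          ≈⟨ ∑-distrib-+ {suc n} (λ r → X * V (toℕ r) k⁻) (λ r → Y * V (toℕ r) k) ⟨
        ∑[ r ≤ n ] (X * V (toℕ r) k⁻ + Y * V (toℕ r) k)
          ≈⟨ sum-cong-≋ {suc n} (λ r → step (Fin.toℕ≤pred[n] r)) ⟩
        ∑[ r ≤ n ] (C (toℕ r) + A (toℕ r))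
          ≈⟨ ∑-distrib-+ {suc n} (λ r → C (toℕ r)) (λ r → A (toℕ r)) ⟩
        ∑[ r ≤ n ] C (toℕ r) + ∑[ r ≤ n ] A (toℕ r)
          ≈⟨ +-congʳ (+-identityʳ _) ⟨
        ∑[ r ≤ n ] C (toℕ r) + 0# + ∑[ r ≤ n ] A (toℕ r)
          -- The extra term `C (suc n)` contains G(n,n+1) = 0. Adding it extends the sum of `C` to n
          -- + 1, so that `C 0` can be split off in front.
          ≈⟨ +-congʳ (+-congˡ (W-zero (suc n) (n ∸ n) k (Gaussian.gaussian-> commutativeSemiring p (ℕ.n<1+n n)))) ⟨
        ∑[ r ≤ n ] C (toℕ r) + C (suc n) + ∑[ r ≤ n ] A (toℕ r)
          ≈⟨ +-congʳ (sum-snoc +-monoid C (suc n)) ⟨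
        C 0 + ∑[ r ≤ n ] C (suc (toℕ r)) + ∑[ r ≤ n ] A (toℕ r)
          ≈⟨ +-assoc _ _ _ ⟩
        C 0 + (∑[ r ≤ n ] C (suc (toℕ r)) + ∑[ r ≤ n ] A (toℕ r))
          ≈⟨ +-congˡ (+-comm _ _) ⟩
        C 0 + (∑[ r ≤ n ] A (toℕ r) + ∑[ r ≤ n ] C (suc (toℕ r)))
          ≈⟨ +-congˡ (∑-distrib-+ {suc n} (λ r → A (toℕ r)) (λ r → C (suc (toℕ r)))) ⟨
        C 0 + ∑[ r ≤ n ] (A (toℕ r) + C (suc (toℕ r)))
          -- `A r` and `C (suc r)` differ only in their Gaussian factor. The leftover `C 0` is
          -- definitionally the summand r = 0 of `T (suc n) k`, since G(n,0) and G(n+1,0) are both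
          -- `1#`.
          ≈⟨ +-congˡ (sum-cong-≋ {suc n} (λ r → combine (Fin.toℕ≤pred[n] r))) ⟩
        T (suc n) k ∎)
        where
        k⁻ = k ℤ.- + 1
        X = q^ (x ℤ.+ a n k⁻)
        Y = h * [ x ℤ.+ a n k ]q
        V : ℕ → ℤ → Carrier
        V r = W (gaussian p n r) r (n ∸ r)
        A C : ℕ → Carrier
        A r = W (p ^ (n ∸ r) * gaussian p n r) (suc r) (n ∸ r) k
        C r = W (gaussian p n r) r (suc n ∸ r) k

        step : ∀ {r} → r ℕ.≤ n → X * V r k⁻ + Y * V r k ≈ C r + A r
        -- The rewrite turns n + 1 - r into 1 + (n - r), the form in which `W-step` produces the
        -- length of the product.
        step {r} r≤n rewrite ℕ.+-∸-assoc 1 r≤n = begin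
          X * V r k⁻ + Y * V r k
            ≡⟨ ≡.cong (λ m → q^ (x ℤ.+ a m k⁻) * V r k⁻ + h * [ x ℤ.+ a m k ]q * V r k) (ℕ.m+[n∸m]≡n r≤n) ⟨
          q^ (x ℤ.+ a (r ℕ.+ (n ∸ r)) k⁻) * V r k⁻ + h * [ x ℤ.+ a (r ℕ.+ (n ∸ r)) k ]q * V r k
            ≈⟨ W-step (gaussian p n r) r (n ∸ r) k ⟩
          W (gaussian p n r) r (suc (n ∸ r)) k + A r ∎

        combine : ∀ {r} → r ℕ.≤ n → A r + C (suc r) ≈ W (gaussian p (suc n) (suc r)) (suc r) (n ∸ r) k
        combine {r} r≤n = sym (trans (W-cong (suc r) (n ∸ r) k (gaussian-pascal commutativeSemiring p r≤n))
                                     (W-+ _ _ (suc r) (n ∸ r) k))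

    -- Expansion of S[n+m,k] over j.

    open Inner using (W; T; T-zero; T-suc)

    -- Equal to `a m j`, but written in the shape used by the theorem.
    offset : ℕ → ℕ → ℤ
    offset m j = + j ℤ.* (+ 1 ℤ.- + s) ℤ.+ + s ℤ.* + m

    -- Since a(n+m,k) = a(m,j) + a(n,k-j), the recurrence `T-suc` at offset a(m,j) has the same
    -- coefficients as the one for S[n+m,k], whatever `j` is. Both sides therefore obey one
    -- recurrence in `n`, and at n = 0 the sum collapses through S[0,k-j].
    S-+ : ∀ n m k → S (n ℕ.+ m) k ≈ ∑[ j ≤ m ] (S m (+ toℕ j) * T (offset m (toℕ j)) n (k ℤ.- + toℕ j))
    S-+ zero m k = sym (trans
      (sum-cong-≋ {suc m} (λ j → *-congˡ {S m (+ toℕ j)} (T-zero (offset m (toℕ j)) (k ℤ.- + toℕ j))))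
      (at k))
      where
      at : ∀ k → ∑[ j ≤ m ] (S m (+ toℕ j) * S 0 (k ℤ.- + toℕ j)) ≈ S m k
      at (+ k)    = ∑-*-S-zero (suc m) (λ j → S m (+ j)) S-> k
      -- For negative k every k - j is negative too, so each term vanishes, as does S[m,k].
      at -[1+ k ] = trans (sum-cong-≋ {suc m} (λ j → trans (*-congˡ (S-zero-neg (toℕ j))) (zeroʳ (S m (+ toℕ j)))))
                          (sum-replicate-zero (suc m))
        where
        S-zero-neg : ∀ j → S 0 (-[1+ k ] ℤ.- + j) ≈ 0#
        S-zero-neg zero    = refl
        S-zero-neg (suc j) = refl
    S-+ (suc n) m k = begin
      S (suc n ℕ.+ m) k
        ≈⟨ S-suc (n ℕ.+ m) k ⟩
      X * S (n ℕ.+ m) k⁻ + Y * S (n ℕ.+ m) k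
        ≈⟨ +-cong (*-congˡ (S-+ n m k⁻)) (*-congˡ (S-+ n m k)) ⟩
      X * ∑[ j ≤ m ] V k⁻ (toℕ j) + Y * ∑[ j ≤ m ] V k (toℕ j)
        ≈⟨ +-cong (*-distribˡ-sum {suc m} X (λ j → V k⁻ (toℕ j)))
                  (*-distribˡ-sum {suc m} Y (λ j → V k (toℕ j))) ⟩
      ∑[ j ≤ m ] (X * V k⁻ (toℕ j)) + ∑[ j ≤ m ] (Y * V k (toℕ j))
        ≈⟨ ∑-distrib-+ {suc m} (λ j → X * V k⁻ (toℕ j)) (λ j → Y * V k (toℕ j)) ⟨
      ∑[ j ≤ m ] (X * V k⁻ (toℕ j) + Y * V k (toℕ j))
        ≈⟨ sum-cong-≋ {suc m} (λ j → step (toℕ j)) ⟩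
      ∑[ j ≤ m ] (S m (+ toℕ j) * T (offset m (toℕ j)) (suc n) (k ℤ.- + toℕ j)) ∎
      where
      k⁻ = k ℤ.- + 1
      X  = q^ (a (n ℕ.+ m) k⁻)
      Y  = h * [ a (n ℕ.+ m) k ]q
      V : ℤ → ℕ → Carrier
      V k j = S m (+ j) * T (offset m j) n (k ℤ.- + j)

      split : ∀ k j → a (n ℕ.+ m) k ≡ offset m j ℤ.+ a n (k ℤ.- + j)
      split k j = at (+ s) (+ n) (+ m) k (+ j)
        where
        at : ∀ s n m k j → s ℤ.* (n ℤ.+ m) ℤ.- (s ℤ.- + 1) ℤ.* k
                         ≡ j ℤ.* (+ 1 ℤ.- s) ℤ.+ s ℤ.* m ℤ.+ (s ℤ.* n ℤ.- (s ℤ.- + 1) ℤ.* (k ℤ.- j))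
        at = solve-∀

      swap : ∀ k j → k ℤ.- + 1 ℤ.- j ≡ k ℤ.- j ℤ.- + 1
      swap = solve-∀

      step : ∀ j → X * V k⁻ j + Y * V k j ≈ S m (+ j) * T (offset m j) (suc n) (k ℤ.- + j)
      step j = begin
        X * V k⁻ j + Y * V k j
          ≡⟨ ≡.cong₂ (λ y z → q^ y * V k⁻ j + h * [ z ]q * V k j) (split k⁻ j) (split k j) ⟩
        q^ (x ℤ.+ a n (k⁻ ℤ.- + j)) * (σ * T x n (k⁻ ℤ.- + j)) + Z * (σ * T x n (k ℤ.- + j))
          ≡⟨ ≡.cong (λ y → q^ (x ℤ.+ a n y) * (σ * T x n y) + Z * (σ * T x n (k ℤ.- + j))) (swap k (+ j)) ⟩
        q^ (x ℤ.+ a n κ⁻) * (σ * T x n κ⁻) + Z * (σ * T x n (k ℤ.- + j))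
          ≈⟨ solve 5 (λ y σ t z t′ → y :* (σ :* t) :+ z :* (σ :* t′) := σ :* (y :* t :+ z :* t′)) refl
               (q^ (x ℤ.+ a n κ⁻)) σ (T x n κ⁻) Z (T x n (k ℤ.- + j)) ⟩
        σ * (q^ (x ℤ.+ a n κ⁻) * T x n κ⁻ + Z * T x n (k ℤ.- + j))
          ≈⟨ *-congˡ (T-suc x n (k ℤ.- + j)) ⟨
        σ * T x (suc n) (k ℤ.- + j) ∎
        where
        x  = offset m j
        σ  = S m (+ j)
        Z  = h * [ x ℤ.+ a n (k ℤ.- + j) ]q
        κ⁻ = k ℤ.- + j ℤ.- + 1

    -- The two identities as double sums.

    coeff : ℕ → ℕ → ℕ → ℕ → Carrier
    coeff n m r j = h ^ (n ∸ r) * q^ (+ r ℤ.* offset m j) * gaussian p n r * S m (+ j)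

    S-+-∑∑ : ∀ n m k → S (n ℕ.+ m) k ≈
             ∑[ r ≤ n ] ∑[ j ≤ m ]
               (coeff n m (toℕ r) (toℕ j) * S (toℕ r) (k ℤ.- + toℕ j) * P (offset m (toℕ j)) (n ∸ toℕ r))
    S-+-∑∑ n m k = begin
      S (n ℕ.+ m) k
        ≈⟨ S-+ n m k ⟩
      ∑[ j ≤ m ] (S m (+ toℕ j) * T (offset m (toℕ j)) n (k ℤ.- + toℕ j))
        ≈⟨ sum-cong-≋ {suc m} step ⟩
      ∑[ j ≤ m ] ∑[ r ≤ n ] F r j
        ≈⟨ ∑-comm {suc n} {suc m} F ⟨
      ∑[ r ≤ n ] ∑[ j ≤ m ] F r j ∎
      where
      F : Fin (suc n) → Fin (suc m) → Carrier
      F r j = coeff n m (toℕ r) (toℕ j) * S (toℕ r) (k ℤ.- + toℕ j) * P (offset m (toℕ j)) (n ∸ toℕ r)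

      step : ∀ j → S m (+ toℕ j) * T (offset m (toℕ j)) n (k ℤ.- + toℕ j) ≈ ∑[ r ≤ n ] F r j
      step j = begin
        S m (+ toℕ j) * T x n κ
          ≈⟨ *-distribˡ-sum {suc n} (S m (+ toℕ j)) (λ r → W x (gaussian p n (toℕ r)) (toℕ r) (n ∸ toℕ r) κ) ⟩
        ∑[ r ≤ n ] (S m (+ toℕ j) * W x (gaussian p n (toℕ r)) (toℕ r) (n ∸ toℕ r) κ)
          ≈⟨ sum-cong-≋ {suc n} (λ r → solve 6
               (λ σ H Q g σ′ R → σ :* (H :* Q :* g :* σ′ :* R) := H :* Q :* g :* σ :* σ′ :* R) refl
               (S m (+ toℕ j)) (h ^ (n ∸ toℕ r)) (q^ (+ toℕ r ℤ.* x)) (gaussian p n (toℕ r))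
               (S (toℕ r) κ) (P x (n ∸ toℕ r))) ⟩
        ∑[ r ≤ n ] F r j ∎
        where
        x = offset m (toℕ j)
        κ = k ℤ.- + toℕ j

    -- In the expansion of S[n+m,k] only the factor S[r,k-j] depends on `k`. Moving the sum over `k`
    -- innermost turns that factor into B[r].
    B-+-∑∑ : ∀ n m → B (n ℕ.+ m) ≈
             ∑[ r ≤ n ] ∑[ j ≤ m ]
               (coeff n m (toℕ r) (toℕ j) * B (toℕ r) * P (offset m (toℕ j)) (n ∸ toℕ r))
    B-+-∑∑ n m = begin
      B N
        ≈⟨ sum-cong-≋ {suc N} (λ k → S-+-∑∑ n m (+ toℕ k)) ⟩
      ∑[ k ≤ N ] ∑[ r ≤ n ] ∑[ j ≤ m ] F k r j
        ≈⟨ ∑-comm {suc N} {suc n} (λ k r → ∑[ j ≤ m ] F k r j) ⟩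
      ∑[ r ≤ n ] ∑[ k ≤ N ] ∑[ j ≤ m ] F k r j
        ≈⟨ sum-cong-≋ {suc n} (λ r → ∑-comm {suc N} {suc m} (λ k j → F k r j)) ⟩
      ∑[ r ≤ n ] ∑[ j ≤ m ] ∑[ k ≤ N ] F k r j
        ≈⟨ sum-cong-≋ {suc n} (λ r → sum-cong-≋ {suc m} (at r)) ⟩
      ∑[ r ≤ n ] ∑[ j ≤ m ] (coeff n m (toℕ r) (toℕ j) * B (toℕ r) * P (offset m (toℕ j)) (n ∸ toℕ r)) ∎
      where
      N = n ℕ.+ m
      F : Fin (suc N) → Fin (suc n) → Fin (suc m) → Carrier
      F k r j = coeff n m (toℕ r) (toℕ j) * S (toℕ r) (+ toℕ k ℤ.- + toℕ j) * P (offset m (toℕ j)) (n ∸ toℕ r)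

      at : ∀ r j → ∑[ k ≤ N ] F k r j ≈ coeff n m (toℕ r) (toℕ j) * B (toℕ r) * P (offset m (toℕ j)) (n ∸ toℕ r)
      at r j = begin
        ∑[ k ≤ N ] F k r j
          ≈⟨ *-distribʳ-sum {suc N} R (λ k → γ * σ k) ⟨
        ∑[ k ≤ N ] (γ * σ k) * R
          ≈⟨ *-congʳ (*-distribˡ-sum {suc N} γ σ) ⟨
        γ * ∑[ k ≤ N ] σ k * R
          -- From r ≤ n and j ≤ m follows r + j ≤ n + m, so no term of B[r] is cut off.
          ≈⟨ *-congʳ (*-congˡ (∑-S-shift (toℕ j) (ℕ.+-mono-≤ (Fin.toℕ≤pred[n] r) (Fin.toℕ≤pred[n] j)))) ⟩
        γ * B (toℕ r) * R ∎
        where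
        γ = coeff n m (toℕ r) (toℕ j)
        R = P (offset m (toℕ j)) (n ∸ toℕ r)
        σ : Fin (suc N) → Carrier
        σ k = S (toℕ r) (+ toℕ k ℤ.- + toℕ j)

theorem18 :
  ∀ {c ℓ₁ ℓ₂} (K : HeytingField c ℓ₁ ℓ₂) → let open HeytingField K in
  (s : ℕ) (h q : Carrier) → h # 0# → (q#0 : q # 0#) (q#?1 : Dec (q # 1#)) →
  let open QNumbers K q q#0 q#?1
      open Stirling s h
  in
  (∀ n m k →
    S (n ℕ.+ m) (+ k) ≈
      ∑[ r ≤ n ] ∑[ j ≤ m ]
        (h ^ (n ∸ toℕ r)
         * q^ (+ toℕ r ℤ.* (+ toℕ j ℤ.* (+ 1 ℤ.- + s) ℤ.+ + s ℤ.* + m))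
         * gaussian (q ^ s) n (toℕ r)
         * S m (+ toℕ j) * S (toℕ r) (+ k ℤ.- + toℕ j)
         * (∏[ i < n ∸ toℕ r ]
             [ + toℕ j ℤ.* (+ 1 ℤ.- + s) ℤ.+ + s ℤ.* + m ℤ.+ + s ℤ.* + toℕ i ]q)))
  ×
  (∀ n m →
    B (n ℕ.+ m) ≈
      ∑[ r ≤ n ] ∑[ j ≤ m ]
        (h ^ (n ∸ toℕ r)
         * q^ (+ toℕ r ℤ.* (+ toℕ j ℤ.* (+ 1 ℤ.- + s) ℤ.+ + s ℤ.* + m))
         * gaussian (q ^ s) n (toℕ r)
         * S m (+ toℕ j) * B (toℕ r)
         * (∏[ i < n ∸ toℕ r ]
             [ + toℕ j ℤ.* (+ 1 ℤ.- + s) ℤ.+ + s ℤ.* + m ℤ.+ + s ℤ.* + toℕ i ]q)))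
theorem18 K s h q _ q#0 q#?1 =
    (λ n m k → S-+-∑∑ K q q#0 q#?1 s h n m (+ k))
  , B-+-∑∑ K q q#0 q#?1 s h
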